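{- Let $m \in \mathbb{N}$ with $m \geq 3$, let $t_0, \dotsc, t_{m-1}$ be Boolean variables with arrival times $a : \{t_0, \dotsc, t_{m-1}\} \to \mathbb{N}$, and let $W := \sum_{i=0}^{m-1} 2^{a(t_i)}$. Then there is a Boolean circuit over $\{\land,\lor\}$ realizing the \textsc{And}-\textsc{Or} path $t_0 \land (t_1 \lor (t_2 \land ( \dotsb t_{m-1}) \dotsb ))$ with delay at most \[ \log_2 W + \log_2 \log_2 m + \log_2 \log_2 \log_2 m + 4.3. \]
   Context: The \textsc{And}-\textsc{Or} path $t_0 \land (t_1 \lor (t_2 \land ( \dotsb t_{m-1}) \dotsb ))$ is the function $g(t)$ defined recursively by $g(t) = g^*(t) = t_0$ for $m = 1$ and, for $m>1$, $g(t) = t_0 \land g^*((t_1,\dotsc,t_{m-1}))$, $g^*(t) = t_0 \lor g((t_1,\dotsc,t_{m-1}))$. A Boolean circuit over $\{\land,\lor\}$ is a directed acyclic graph whose indegree-0 nodes (inputs) are labeled by Boolean variables, with a unique outdegree-0 node (output) of indegree 1, and all other nodes are gates of indegree exactly 2 labeled \textsc{And} or \textsc{Or}; it realizes a Boolean function if its output computes that function for all input values. The delay of an input $x$ is $a(x)$ plus the maximum number of gates on any directed path starting at $x$; the delay of the circuit is the maximum delay over its inputs. -}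

module Defs where

open import Data.Nat using (ℕ; zero; suc; _+_; _*_; _^_; _<_; _≤_)
open import Data.Bool using (Bool; true; false; _∧_; _∨_)
open import Data.Fin using (Fin)
import Data.Fin as F
open import Data.Sum using (_⊎_; inj₁; inj₂)
open import Data.Product using (_×_; ∃-syntax)
open import Data.Unit using (⊤)
open import Data.List using (List; []; _∷_)
open import Data.Nat.ListAction using (sum)
import Data.List as L
open import Relation.Binary.PropositionalEquality using (_≡_)

-- The And-Or path  t0 ∧ (t1 ∨ (t2 ∧ (... t_{m-1})...))
-- andOr = g, orAnd = g*  (defined on the list of input values t0,...,t_{m-1};
-- the value on the empty list is an irrelevant convention, m ≥ 1 is assumed).

mutual
  andOr : List Bool → Bool
  andOr []             = true
  andOr (x ∷ [])       = x
  andOr (x ∷ y ∷ ys)   = x ∧ orAnd (y ∷ ys)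

  orAnd : List Bool → Bool
  orAnd []             = false
  orAnd (x ∷ [])       = x
  orAnd (x ∷ y ∷ ys)   = x ∨ andOr (y ∷ ys)

andOrPath : (m : ℕ) → (Fin m → Bool) → Bool
andOrPath m σ = andOr (L.tabulate σ)

-- Boolean circuits over {And, Or} on the variables t_0 ... t_{m-1}.
-- Nodes are input nodes (labelled by a variable, Fin m) or gates (Fin size).
-- Each gate has exactly two incoming edges (childL, childR); acyclicity is
-- ensured by requiring gate children to be gates of smaller index.
-- The unique output node has exactly one predecessor, 'out'.

data Op : Set where
  AND OR : Op

apply : Op → Bool → Bool → Bool
apply AND x y = x ∧ y
apply OR  x y = x ∨ y

Node : ℕ → ℕ → Set
Node m size = Fin m ⊎ Fin size

Below : ∀ {m size} → Fin size → Node m size → Set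
Below k (inj₁ _) = ⊤
Below k (inj₂ j) = j F.< k

record Circuit (m : ℕ) : Set where
  field
    size   : ℕ
    op     : Fin size → Op
    childL : Fin size → Node m size
    childR : Fin size → Node m size
    acycL  : ∀ k → Below k (childL k)
    acycR  : ∀ k → Below k (childR k)
    out    : Node m size

open Circuit public

nodeVal : ∀ {m size} → (Fin m → Bool) → (Fin size → Bool) → Node m size → Bool
nodeVal σ val (inj₁ i) = σ i
nodeVal σ val (inj₂ j) = val j

-- val is the gate valuation computed by C under input assignment σ
-- (unique, and it exists, since C is acyclic)
Consistent : ∀ {m} (C : Circuit m) → (Fin m → Bool) → (Fin (size C) → Bool) → Set
Consistent C σ val =
  ∀ k → val k ≡ apply (op C k) (nodeVal σ val (childL C k)) (nodeVal σ val (childR C k))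

Realizes : ∀ {m} → Circuit m → ((Fin m → Bool) → Bool) → Set
Realizes C f =
  ∀ σ val → Consistent C σ val → nodeVal σ val (out C) ≡ f σ

isGate : ∀ {m size} → Node m size → ℕ
isGate (inj₁ _) = 0
isGate (inj₂ _) = 1

data PathToOut {m} (C : Circuit m) : Node m (size C) → ℕ → Set where
  atOut : PathToOut C (out C) (isGate (out C))
  viaL  : ∀ k ℓ → PathToOut C (inj₂ k) ℓ →
          PathToOut C (childL C k) (isGate (childL C k) + ℓ)
  viaR  : ∀ k ℓ → PathToOut C (inj₂ k) ℓ →
          PathToOut C (childR C k) (isGate (childR C k) + ℓ)

DelayAtMost : ∀ {m} → Circuit m → (Fin m → ℕ) → ℕ → Set
DelayAtMost C arr d = ∀ i ℓ → PathToOut C (inj₁ i) ℓ → arr i + ℓ ≤ d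

weight : ∀ m → (Fin m → ℕ) → ℕ
weight m arr = sum (L.tabulate (λ i → 2 ^ arr i))

-- The real inequality   d ≤ log₂ W + log₂ log₂ m + log₂ log₂ log₂ m + 4.3
-- expressed without real numbers.  With L = log₂ m and
-- X = L · log₂ L (> 0 for m ≥ 3), the inequality is equivalent to
--   K := 2^(10 d) / (2^43 · W^10)  ≤  X^10,
-- i.e. every nonnegative rational r = s/t < K satisfies r < X^10, and
-- r < X^10 holds iff there are positive rationals u = a/b < L and
-- v = c/e < log₂ u with r < (u·v)^10. Here
--   a/b < log₂ m    ⇔  2^a < m^b,
--   c/e < log₂(a/b) ⇔  2^c · b^e < a^e,
--   s/t < (uv)^10   ⇔  s · (b·e)^10 < t · (a·c)^10,
--   s/t < K         ⇔  s · 2^43 · W^10 < t · 2^(10 d).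

BoundHolds : (m W d : ℕ) → Set
BoundHolds m W d =
  ∀ s t → 0 < t → s * 2 ^ 43 * W ^ 10 < t * 2 ^ (10 * d) →
  ∃[ a ] ∃[ b ] ∃[ c ] ∃[ e ]
    (0 < b × 0 < e × 2 ^ a < m ^ b × 2 ^ c * b ^ e < a ^ e
     × s * (b * e) ^ 10 < t * (a * c) ^ 10)

{-# OPTIONS --safe #-}
module Submission where

-- Write f ∧ g*(T) for an And-Or path whose leading input f is itself realized with delay k. Grinchuk's identity
--   f ∧ g*(T′ ++ c ∷ T″) = (f ∧ g*(T′)) ∧ (⋁ (odd-position inputs of T′, c) ∨ g(T″)),  |T′| even,
-- splits it into two such functions. By induction on d, the path f ∧ g*(T ++ [ l ]) has delay at most d whenever
--   2 ^ k + 2 * w(l) + 2 * d * w(T) ≤ 2 ^ d,  where w(t) = 2 ^ a(t):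
-- take the longest prefix T′ whose left factor satisfies the condition for d - 1. As the next longer prefix violates it,
-- the right factor satisfies it too. There the disjunction is a balanced tree, at the price of at most doubling its
-- weight; the last input, cheap in the condition, absorbs a heavy input at the end of T′ and c one at the start of T″.
--
-- So a delay d with 2 d W ≤ 2 ^ d is possible. Replacing a(t) by a(t) ∸ r with r maximal such that m 2 ^ r ≤ W costs
-- a factor of 2 in W and makes d of order log m. For m < 8 the path itself is fast enough.

open import Defs
open import Data.Bool using (Bool; true; false; _∧_; _∨_)
open import Data.Bool.Properties using (∧-identityʳ; ∨-identityʳ; ∧-assoc; ∨-assoc; ∧-comm; ∨-comm)
open import Data.Fin using (Fin; zero; suc; splitAt; join; _↑ˡ_; _↑ʳ_)
open import Data.Fin.Properties using (splitAt-join; join-splitAt; toℕ-↑ˡ; toℕ-↑ʳ; toℕ<n)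
open import Data.List using (List; []; _∷_; _++_; [_]; map; foldr; length; tabulate; allFin; initLast; _∷ʳ′_)
open import Data.List.Properties using (map-++; ++-assoc; map-tabulate; length-tabulate)
open import Data.Nat using (ℕ; zero; suc; _+_; _*_; _^_; _∸_; _≤_; _<_; z≤n; s≤s; NonZero; >-nonZero; _<?_; _≤?_)
open import Data.Nat.ListAction using (sum)
open import Data.Nat.ListAction.Properties using (sum-++)
open import Data.Nat.Properties
open import Data.Nat.Tactic.RingSolver using (solve-∀)
open import Data.Product using (_×_; _,_; ∃-syntax; proj₁)
open import Data.Sum using (_⊎_; inj₁; inj₂)
import Data.Sum as Sum
open import Data.Unit using (tt)
open import Function using (_∘_; id)
open import Relation.Binary.PropositionalEquality using (_≡_; _≗_; refl; sym; trans; cong; cong₂; subst; module ≡-Reasoning)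
open import Relation.Nullary using (¬_; Dec; yes; no; contradiction)
open import Relation.Nullary.Decidable using (from-yes)

-- Circuits with levels that certify the delay.

BooleanFunction : ℕ → Set
BooleanFunction m = (Fin m → Bool) → Bool

nodeLevel : ∀ {m size} → (Fin m → ℕ) → (Fin size → ℕ) → Node m size → ℕ
nodeLevel arr level (inj₁ i) = arr i
nodeLevel arr level (inj₂ j) = level j

-- A level bounds the time at which the value of a gate is available. It is checked edge by edge, so
-- circuits can be joined without looking at their paths.
record Realizable {m} (arr : Fin m → ℕ) (d : ℕ) (f : BooleanFunction m) : Set where
  field
    circuit  : Circuit m
    realizes : Realizes circuit f
    level    : Fin (size circuit) → ℕ
    levelL   : ∀ k → nodeLevel arr level (childL circuit k) < level k
    levelR   : ∀ k → nodeLevel arr level (childR circuit k) < level k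
    levelOut : nodeLevel arr level (out circuit) ≤ d

open Realizable

delayAtMost : ∀ {m} {arr : Fin m → ℕ} {d f} (R : Realizable arr d f) →
              DelayAtMost (circuit R) arr d
delayAtMost {arr = arr} {d} R i ℓ p = subst (arr i + ℓ ≤_) (+-identityʳ d) (bound p)
  where
  open ≤-Reasoning
  lev = nodeLevel arr (level R)

  step : ∀ {l n} g ℓ → l < n → n + ℓ ≤ d + 1 → l + (g + ℓ) ≤ d + g
  step {l} {n} g ℓ l<n n+ℓ≤ = +-cancelʳ-≤ 1 _ _ (begin
    l + (g + ℓ) + 1  ≡⟨ lemma l g ℓ ⟩
    suc l + ℓ + g    ≤⟨ +-monoˡ-≤ g (+-monoˡ-≤ ℓ l<n) ⟩
    n + ℓ + g        ≤⟨ +-monoˡ-≤ g n+ℓ≤ ⟩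
    d + 1 + g        ≡⟨ lemma′ d g ⟩
    d + g + 1        ∎)
    where
    lemma : ∀ l g ℓ → l + (g + ℓ) + 1 ≡ suc l + ℓ + g
    lemma = solve-∀
    lemma′ : ∀ d g → d + 1 + g ≡ d + g + 1
    lemma′ = solve-∀

  -- `ℓ` counts `n` itself when `n` is a gate, hence the summand `isGate n` on the right.
  bound : ∀ {n ℓ} → PathToOut (circuit R) n ℓ → lev n + ℓ ≤ d + isGate n
  bound atOut        = +-monoˡ-≤ _ (levelOut R)
  bound (viaL k ℓ p) = step (isGate (childL (circuit R) k)) ℓ (levelL R k) (bound p)
  bound (viaR k ℓ p) = step (isGate (childR (circuit R) k)) ℓ (levelR R k) (bound p)

realizable-≤ : ∀ {m} {arr : Fin m → ℕ} {d d′ f} → d ≤ d′ → Realizable arr d f → Realizable arr d′ f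
realizable-≤ d≤d′ R = record
  { circuit = circuit R ; realizes = realizes R ; level = level R
  ; levelL = levelL R ; levelR = levelR R ; levelOut = ≤-trans (levelOut R) d≤d′ }

realizable-≗ : ∀ {m} {arr : Fin m → ℕ} {d} {f g : BooleanFunction m} → f ≗ g → Realizable arr d f → Realizable arr d g
realizable-≗ f≗g R = record
  { circuit = circuit R ; realizes = λ σ val c → trans (realizes R σ val c) (f≗g σ) ; level = level R
  ; levelL = levelL R ; levelR = levelR R ; levelOut = levelOut R }

realizable-input : ∀ {m} (arr : Fin m → ℕ) i → Realizable arr (arr i) (λ σ → σ i)
realizable-input arr i = record
  { circuit = record { size = 0 ; op = λ () ; childL = λ () ; childR = λ () ; acycL = λ () ; acycR = λ () ; out = inj₁ i }
  ; realizes = λ σ val c → refl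
  ; level = λ () ; levelL = λ () ; levelR = λ () ; levelOut = ≤-refl }

-- Joining two circuits by a new gate.

module _ {m} {arr : Fin m → ℕ} {d} {f g : BooleanFunction m}
         (o : Op) (R₁ : Realizable arr d f) (R₂ : Realizable arr d g) where

  private
    C₁ = circuit R₁
    C₂ = circuit R₂
    n₁ = size C₁
    n₂ = size C₂
    n  = n₁ + (n₂ + 1)

    -- The order of the summands is the order of the indices. The new gate comes last, so every gate
    -- child has a smaller index than its parent.
    Position : Set
    Position = Fin n₁ ⊎ (Fin n₂ ⊎ Fin 1)

    index : Position → Fin n
    index = join n₁ (n₂ + 1) ∘ Sum.map₂ (join n₂ 1)

    position : Fin n → Position
    position = Sum.map₂ (splitAt n₂) ∘ splitAt n₁

    position-index : ∀ q → position (index q) ≡ q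
    position-index (inj₁ j) rewrite splitAt-join n₁ (n₂ + 1) (inj₁ j) = refl
    position-index (inj₂ q) rewrite splitAt-join n₁ (n₂ + 1) (inj₂ (join n₂ 1 q)) =
      cong inj₂ (splitAt-join n₂ 1 q)

    index-position : ∀ k → index (position k) ≡ k
    index-position k with splitAt n₁ k | join-splitAt n₁ (n₂ + 1) k
    ... | inj₁ j | eq = eq
    ... | inj₂ j | eq = trans (cong (n₁ ↑ʳ_) (join-splitAt n₂ 1 j)) eq

    fromLeft : Node m n₁ → Node m n
    fromLeft = Sum.map₂ (index ∘ inj₁)

    fromRight : Node m n₂ → Node m n
    fromRight = Sum.map₂ (index ∘ inj₂ ∘ inj₁)

    gateOp : Position → Op
    gateOp (inj₁ j)        = op C₁ j
    gateOp (inj₂ (inj₁ j)) = op C₂ j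
    gateOp (inj₂ (inj₂ _)) = o

    gateL gateR : Position → Node m n
    gateL (inj₁ j)        = fromLeft (childL C₁ j)
    gateL (inj₂ (inj₁ j)) = fromRight (childL C₂ j)
    gateL (inj₂ (inj₂ _)) = fromLeft (out C₁)
    gateR (inj₁ j)        = fromLeft (childR C₁ j)
    gateR (inj₂ (inj₁ j)) = fromRight (childR C₂ j)
    gateR (inj₂ (inj₂ _)) = fromRight (out C₂)

    gateLevel : Position → ℕ
    gateLevel (inj₁ j)        = level R₁ j
    gateLevel (inj₂ (inj₁ j)) = level R₂ j
    gateLevel (inj₂ (inj₂ _)) = suc d

    top : Fin n
    top = index (inj₂ (inj₂ zero))

    fromLeft-below : ∀ j c → Below j c → Below (index (inj₁ j)) (fromLeft c)
    fromLeft-below j (inj₁ _) _   = tt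
    fromLeft-below j (inj₂ i) i<j rewrite toℕ-↑ˡ i (n₂ + 1) | toℕ-↑ˡ j (n₂ + 1) = i<j

    fromRight-below : ∀ j c → Below j c → Below (index (inj₂ (inj₁ j))) (fromRight c)
    fromRight-below j (inj₁ _) _   = tt
    fromRight-below j (inj₂ i) i<j
      rewrite toℕ-↑ʳ n₁ (i ↑ˡ 1) | toℕ-↑ʳ n₁ (j ↑ˡ 1) | toℕ-↑ˡ i 1 | toℕ-↑ˡ j 1 = +-monoʳ-< n₁ i<j

    fromLeft-below-top : ∀ c → Below top (fromLeft c)
    fromLeft-below-top (inj₁ _) = tt
    fromLeft-below-top (inj₂ i)
      rewrite toℕ-↑ˡ i (n₂ + 1) | toℕ-↑ʳ n₁ (n₂ ↑ʳ zero {0}) = ≤-trans (toℕ<n i) (m≤m+n n₁ _)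

    fromRight-below-top : ∀ c → Below top (fromRight c)
    fromRight-below-top (inj₁ _) = tt
    fromRight-below-top (inj₂ i)
      rewrite toℕ-↑ʳ n₁ (i ↑ˡ 1) | toℕ-↑ʳ n₁ (n₂ ↑ʳ zero {0}) | toℕ-↑ˡ i 1 | toℕ-↑ʳ n₂ (zero {0}) =
      +-monoʳ-< n₁ (≤-trans (toℕ<n i) (m≤m+n n₂ 0))

    gateL-below : ∀ q → Below (index q) (gateL q)
    gateL-below (inj₁ j)           = fromLeft-below j _ (acycL C₁ j)
    gateL-below (inj₂ (inj₁ j))    = fromRight-below j _ (acycL C₂ j)
    gateL-below (inj₂ (inj₂ zero)) = fromLeft-below-top (out C₁)

    gateR-below : ∀ q → Below (index q) (gateR q)
    gateR-below (inj₁ j)           = fromLeft-below j _ (acycR C₁ j)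
    gateR-below (inj₂ (inj₁ j))    = fromRight-below j _ (acycR C₂ j)
    gateR-below (inj₂ (inj₂ zero)) = fromRight-below-top (out C₂)

    C : Circuit m
    C = record
      { size   = n
      ; op     = gateOp ∘ position
      ; childL = gateL ∘ position
      ; childR = gateR ∘ position
      ; acycL  = λ k → subst (λ i → Below i (gateL (position k))) (index-position k) (gateL-below (position k))
      ; acycR  = λ k → subst (λ i → Below i (gateR (position k))) (index-position k) (gateR-below (position k))
      ; out    = inj₂ top
      }

    module _ (σ : Fin m → Bool) (val : Fin n → Bool) (consistent : Consistent C σ val) where

      val-gate : ∀ q → val (index q) ≡ apply (gateOp q) (nodeVal σ val (gateL q)) (nodeVal σ val (gateR q))
      val-gate q = subst
        (λ p → val (index q) ≡ apply (gateOp p) (nodeVal σ val (gateL p)) (nodeVal σ val (gateR p)))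
        (position-index q) (consistent (index q))

      fromLeft-val : ∀ c → nodeVal σ val (fromLeft c) ≡ nodeVal σ (val ∘ index ∘ inj₁) c
      fromLeft-val (inj₁ _) = refl
      fromLeft-val (inj₂ _) = refl

      fromRight-val : ∀ c → nodeVal σ val (fromRight c) ≡ nodeVal σ (val ∘ index ∘ inj₂ ∘ inj₁) c
      fromRight-val (inj₁ _) = refl
      fromRight-val (inj₂ _) = refl

      -- A consistent valuation of `C` restricts to consistent valuations of `C₁` and `C₂`, to which
      -- `realizes` applies.
      top-val : val top ≡ apply o (f σ) (g σ)
      top-val = trans (val-gate (inj₂ (inj₂ zero))) (cong₂ (apply o)
        (trans (fromLeft-val (out C₁)) (realizes R₁ σ _ λ j →
          trans (val-gate (inj₁ j)) (cong₂ (apply (op C₁ j)) (fromLeft-val (childL C₁ j)) (fromLeft-val (childR C₁ j)))))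
        (trans (fromRight-val (out C₂)) (realizes R₂ σ _ λ j →
          trans (val-gate (inj₂ (inj₁ j))) (cong₂ (apply (op C₂ j)) (fromRight-val (childL C₂ j)) (fromRight-val (childR C₂ j))))))

    lev : Node m n → ℕ
    lev = nodeLevel arr (gateLevel ∘ position)

    fromLeft-level : ∀ c → lev (fromLeft c) ≡ nodeLevel arr (level R₁) c
    fromLeft-level (inj₁ _) = refl
    fromLeft-level (inj₂ j) = cong gateLevel (position-index (inj₁ j))

    fromRight-level : ∀ c → lev (fromRight c) ≡ nodeLevel arr (level R₂) c
    fromRight-level (inj₁ _) = refl
    fromRight-level (inj₂ j) = cong gateLevel (position-index (inj₂ (inj₁ j)))

    gateL-level : ∀ q → lev (gateL q) < gateLevel q
    gateL-level (inj₁ j)        rewrite fromLeft-level (childL C₁ j)  = levelL R₁ j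
    gateL-level (inj₂ (inj₁ j)) rewrite fromRight-level (childL C₂ j) = levelL R₂ j
    gateL-level (inj₂ (inj₂ _)) rewrite fromLeft-level (out C₁)       = s≤s (levelOut R₁)

    gateR-level : ∀ q → lev (gateR q) < gateLevel q
    gateR-level (inj₁ j)        rewrite fromLeft-level (childR C₁ j)  = levelR R₁ j
    gateR-level (inj₂ (inj₁ j)) rewrite fromRight-level (childR C₂ j) = levelR R₂ j
    gateR-level (inj₂ (inj₂ _)) rewrite fromRight-level (out C₂)      = s≤s (levelOut R₂)

  realizable-gate : Realizable arr (suc d) (λ σ → apply o (f σ) (g σ))
  realizable-gate = record
    { circuit  = C
    ; realizes = top-val
    ; level    = gateLevel ∘ position
    ; levelL   = gateL-level ∘ position
    ; levelR   = gateR-level ∘ position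
    ; levelOut = ≤-reflexive (cong gateLevel (position-index (inj₂ (inj₂ zero))))
    }

-- And-Or duality and Grinchuk's identity.

dual : Op → Op
dual AND = OR
dual OR  = AND

unit : Op → Bool
unit AND = true
unit OR  = false

dual-involutive : ∀ o → dual (dual o) ≡ o
dual-involutive AND = refl
dual-involutive OR  = refl

apply-identityˡ : ∀ o x → apply o (unit o) x ≡ x
apply-identityˡ AND x = refl
apply-identityˡ OR  x = refl

apply-identityʳ : ∀ o x → apply o x (unit o) ≡ x
apply-identityʳ AND = ∧-identityʳ
apply-identityʳ OR  = ∨-identityʳ

apply-assoc : ∀ o x y z → apply o (apply o x y) z ≡ apply o x (apply o y z)
apply-assoc AND = ∧-assoc
apply-assoc OR  = ∨-assoc

apply-comm : ∀ o x y → apply o x y ≡ apply o y x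
apply-comm AND = ∧-comm
apply-comm OR  = ∨-comm

apply-exchange : ∀ o x y z → apply o x (apply o y z) ≡ apply o y (apply o x z)
apply-exchange o x y z = begin
  apply o x (apply o y z)  ≡⟨ apply-assoc o x y z ⟨
  apply o (apply o x y) z  ≡⟨ cong (λ w → apply o w z) (apply-comm o x y) ⟩
  apply o (apply o y x) z  ≡⟨ apply-assoc o y x z ⟩
  apply o y (apply o x z)  ∎
  where open ≡-Reasoning

-- Distributivity of `o` over `dual o` up to reassociation, the induction step of Grinchuk's
-- identity. Deciding `a` leaves an absorbing value on both sides or plain associativity.
apply-distrib : ∀ o a b x z → apply o a (apply (dual o) b (apply (dual o) x z)) ≡
                apply (dual o) (apply o a (apply (dual o) b x)) (apply o a z)
apply-distrib AND true  b x z = sym (∨-assoc b x z)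
apply-distrib AND false b x z = refl
apply-distrib OR  true  b x z = refl
apply-distrib OR  false b x z = sym (∧-assoc b x z)

fold : Op → List Bool → Bool
fold o = foldr (apply o) (unit o)

-- The value at `[]` is neutral for the operation that precedes it, so singletons need no clause of
-- their own. It differs from that of `andOr` and `orAnd`, with which `path` agrees on nonempty
-- lists only.
path : Op → List Bool → Bool
path o []       = unit (dual o)
path o (x ∷ xs) = apply o x (path (dual o) xs)

mutual
  path-andOr : ∀ x xs → path AND (x ∷ xs) ≡ andOr (x ∷ xs)
  path-andOr x []       = ∧-identityʳ x
  path-andOr x (y ∷ ys) = cong (x ∧_) (path-orAnd y ys)

  path-orAnd : ∀ x xs → path OR (x ∷ xs) ≡ orAnd (x ∷ xs)
  path-orAnd x []       = ∨-identityʳ x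
  path-orAnd x (y ∷ ys) = cong (x ∨_) (path-andOr y ys)

-- A prefix of even length is kept as a list of pairs, so that `map proj₁` yields its odd-position
-- inputs.
flatten : ∀ {A : Set} → List (A × A) → List A
flatten []             = []
flatten ((a , b) ∷ ps) = a ∷ b ∷ flatten ps

flatten-∷ʳ : ∀ {A : Set} (ps : List (A × A)) a b → flatten (ps ++ [ a , b ]) ≡ flatten ps ++ a ∷ b ∷ []
flatten-∷ʳ []             a b = refl
flatten-∷ʳ ((c , d) ∷ ps) a b = cong (λ l → c ∷ d ∷ l) (flatten-∷ʳ ps a b)

-- Induction on the pairs: `b` goes into the left factor, while `a` distributes over both factors
-- and thereby enters the fold of the right one. Without pairs the left factor is the unit of
-- `dual o`.
path-split : ∀ {A : Set} o (h : A → Bool) (ps : List (A × A)) c r →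
             path o (map h (flatten ps ++ c ∷ r)) ≡
             apply (dual o) (path o (map h (flatten ps)))
                            (apply o (fold o (map h (map proj₁ ps ++ [ c ]))) (path (dual o) (map h r)))
path-split o h [] c r
  rewrite apply-identityʳ o (h c) | apply-identityˡ (dual o) (apply o (h c) (path (dual o) (map h r))) = refl
path-split o h ((a , b) ∷ ps) c r rewrite dual-involutive o | path-split o h ps c r = begin
  apply o (h a) (apply (dual o) (h b) (apply (dual o) x (apply o y z)))
    ≡⟨ apply-distrib o (h a) (h b) x (apply o y z) ⟩
  apply (dual o) (apply o (h a) (apply (dual o) (h b) x)) (apply o (h a) (apply o y z))
    ≡⟨ cong (apply (dual o) _) (apply-assoc o (h a) y z) ⟨
  apply (dual o) (apply o (h a) (apply (dual o) (h b) x)) (apply o (apply o (h a) y) z)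
    ∎
  where
  open ≡-Reasoning
  x = path o (map h (flatten ps))
  y = fold o (map h (map proj₁ ps ++ [ c ]))
  z = path (dual o) (map h r)

fold-++ : ∀ o xs ys → fold o (xs ++ ys) ≡ apply o (fold o xs) (fold o ys)
fold-++ o []       ys = sym (apply-identityˡ o _)
fold-++ o (x ∷ xs) ys = trans (cong (apply o x) (fold-++ o xs ys)) (sym (apply-assoc o x _ _))

-- Logarithms and the arithmetic of the induction.

n<2^n : ∀ n → n < 2 ^ n
n<2^n zero    = s≤s z≤n
n<2^n (suc n) = begin-strict
  suc n        ≤⟨ n<2^n n ⟩
  2 ^ n        <⟨ m<m+n (2 ^ n) (m≤n⇒m≤n+o 0 (m^n>0 2 n)) ⟩
  2 * 2 ^ n    ∎
  where open ≤-Reasoning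

-- A discrete intermediate value principle; it supplies the logarithms, the delay and the rounding
-- exponent.
crossing : ∀ {P : ℕ → Set} → (∀ k → Dec (P k)) → ∀ n → P 0 → ¬ P n → ∃[ k ] (k < n × P k × ¬ P (suc k))
crossing P? zero    p₀ ¬pₙ = contradiction p₀ ¬pₙ
crossing P? (suc n) p₀ ¬pₙ with P? n
... | yes pₙ = n , ≤-refl , pₙ , ¬pₙ
... | no ¬p  with crossing P? n p₀ ¬p
...   | k , k<n , pₖ , ¬pₖ₊₁ = k , m<n⇒m<1+n k<n , pₖ , ¬pₖ₊₁

floorLog : ∀ n → 0 < n → ∃[ k ] (2 ^ k ≤ n × n < 2 ^ suc k)
floorLog n 0<n with crossing (λ k → 2 ^ k ≤? n) n 0<n (<⇒≱ (n<2^n n))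
... | k , _ , 2^k≤n , ¬2^1+k≤n = k , 2^k≤n , ≰⇒> ¬2^1+k≤n

ceilLog : ∀ n → 0 < n → ∃[ k ] (n ≤ 2 ^ k × 2 ^ k ≤ 2 * n)
ceilLog n 0<n with crossing (λ k → 2 ^ k <? 2 * n) (suc n) (*-monoʳ-≤ 2 0<n) (≤⇒≯ (*-monoʳ-≤ 2 (<⇒≤ (n<2^n n))))
... | k , _ , 2^k<2n , ¬2^1+k<2n = k , *-cancelˡ-≤ 2 (≮⇒≥ ¬2^1+k<2n) , <⇒≤ 2^k<2n

-- Here `E` is `2 * e` and `P` is `2 ^ e`; `u`, `γ`, `β`, `ρ`, `z` are the weights of the prefix, of
-- `c`, of `b`, of the inputs after `b` and of the last input. The failed condition pays for one of
-- the two `P`. The increase of the coefficient from `E` to `2 + E` pays for the rounded weight `K`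
-- of the fold and for `2 * β`, the price of `b` as last input of the rejected prefix.
right-bound : ∀ {K ω E P} X u γ β ρ z → K ≤ 2 * ω → ω ≤ u + γ → ¬ (X + 2 * β + E * (u + γ) ≤ P) →
              X + 2 * z + (2 + E) * (u + (γ + (β + ρ))) ≤ 2 * P → K + 2 * z + E * (β + ρ) ≤ P
right-bound {K} {ω} {E} {P} X u γ β ρ z K≤ ω≤ fails total = +-cancelʳ-≤ P _ _ (begin
  K + 2 * z + E * (β + ρ) + P
    ≤⟨ +-mono-≤ (+-monoˡ-≤ (E * (β + ρ)) (+-monoˡ-≤ (2 * z) (≤-trans K≤ (*-monoʳ-≤ 2 ω≤)))) (<⇒≤ (≰⇒> fails)) ⟩
  2 * (u + γ) + 2 * z + E * (β + ρ) + (X + 2 * β + E * (u + γ))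
    ≤⟨ m≤m+n _ (2 * ρ) ⟩
  2 * (u + γ) + 2 * z + E * (β + ρ) + (X + 2 * β + E * (u + γ)) + 2 * ρ
    ≡⟨ rearrange X u γ β ρ z E ⟩
  X + 2 * z + (2 + E) * (u + (γ + (β + ρ)))
    ≤⟨ total ⟩
  2 * P
    ≡⟨ cong (P +_) (+-identityʳ P) ⟩
  P + P ∎)
  where
  open ≤-Reasoning
  rearrange : ∀ X u γ β ρ z E →
    2 * (u + γ) + 2 * z + E * (β + ρ) + (X + 2 * β + E * (u + γ)) + 2 * ρ ≡
    X + 2 * z + (2 + E) * (u + (γ + (β + ρ)))
  rearrange = solve-∀

-- Serves the end of the search, where the right factor is a mere fold: both `w` and `z` occur in
-- `total` with coefficient at least 2, and halving gives Kraft's condition for `P`.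
tree-bound : ∀ {ω P} X E w z → ω ≤ w + z → X + 2 * z + (2 + E) * w ≤ 2 * P → ω ≤ P
tree-bound {ω} {P} X E w z ω≤ total = *-cancelˡ-≤ 2 (begin
  2 * ω                          ≤⟨ *-monoʳ-≤ 2 ω≤ ⟩
  2 * (w + z)                    ≤⟨ m≤m+n _ (X + E * w) ⟩
  2 * (w + z) + (X + E * w)      ≡⟨ rearrange X E w z ⟩
  X + 2 * z + (2 + E) * w        ≤⟨ total ⟩
  2 * P                          ∎)
  where
  open ≤-Reasoning
  rearrange : ∀ X E w z → 2 * (w + z) + (X + E * w) ≡ X + 2 * z + (2 + E) * w
  rearrange = solve-∀

-- Balanced trees over items of different levels.

module _ {m} (arr : Fin m → ℕ) where

  -- The level is relative to the offset j.
  record Item (j : ℕ) : Set where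
    constructor item
    field
      fn         : BooleanFunction m
      lvl        : ℕ
      realizable : Realizable arr (lvl + j) fn

  open Item

  itemWeight : ∀ {j} → List (Item j) → ℕ
  itemWeight = sum ∘ map (λ x → 2 ^ lvl x)

  itemFold : ∀ {j} → Op → List (Item j) → BooleanFunction m
  itemFold o xs σ = fold o (map (λ x → fn x σ) xs)

  lower : ∀ {j f} a → Realizable arr (suc a + j) f → Item (suc j)
  lower {j} a R = item _ a (realizable-≤ (≤-reflexive (sym (+-suc a j))) R)

  -- Items of relative level 0 are paired up; in pairUp′, one of them is waiting for a partner.
  mutual
    pairUp : ∀ {j} → Op → List (Item j) → List (Item (suc j))
    pairUp o []                     = []
    pairUp o (item f zero R ∷ xs)    = pairUp′ o R xs
    pairUp o (item f (suc a) R ∷ xs) = lower a R ∷ pairUp o xs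

    pairUp′ : ∀ {j f} → Op → Realizable arr j f → List (Item j) → List (Item (suc j))
    pairUp′ o P []                     = item _ 0 (realizable-≤ (n≤1+n _) P) ∷ []
    pairUp′ o P (item f zero R ∷ xs)    = item _ 0 (realizable-gate o P R) ∷ pairUp o xs
    pairUp′ o P (item f (suc a) R ∷ xs) = lower a R ∷ pairUp′ o P xs

  mutual
    pairUp-fold : ∀ {j} o (xs : List (Item j)) σ → itemFold o (pairUp o xs) σ ≡ itemFold o xs σ
    pairUp-fold o [] σ                     = refl
    pairUp-fold o (item f zero R ∷ xs) σ    = pairUp′-fold o R xs σ
    pairUp-fold o (item f (suc a) R ∷ xs) σ = cong (apply o (f σ)) (pairUp-fold o xs σ)

    pairUp′-fold : ∀ {j f} o (P : Realizable arr j f) xs σ →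
                   itemFold o (pairUp′ o P xs) σ ≡ apply o (f σ) (itemFold o xs σ)
    pairUp′-fold o P [] σ = refl
    pairUp′-fold {f = g} o P (item f zero R ∷ xs) σ =
      trans (cong (apply o _) (pairUp-fold o xs σ)) (apply-assoc o (g σ) (f σ) _)
    pairUp′-fold {f = g} o P (item f (suc a) R ∷ xs) σ =
      trans (cong (apply o (f σ)) (pairUp′-fold o P xs σ)) (apply-exchange o (f σ) (g σ) _)

  mutual
    -- A pair of items of level 0 becomes one item of level 0, so doubling restores its weight. At
    -- most one item stays alone, and it then counts 2 instead of 1.
    pairUp-≤ : ∀ {j} o (xs : List (Item j)) → 2 * itemWeight (pairUp o xs) ≤ 1 + itemWeight xs
    pairUp-≤ o []                     = z≤n
    pairUp-≤ o (item f zero R ∷ xs)    = pairUp′-≤ o R xs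
    pairUp-≤ o (item f (suc a) R ∷ xs) = begin
      2 * (2 ^ a + itemWeight (pairUp o xs))      ≡⟨ *-distribˡ-+ 2 (2 ^ a) _ ⟩
      2 ^ suc a + 2 * itemWeight (pairUp o xs)    ≤⟨ +-monoʳ-≤ (2 ^ suc a) (pairUp-≤ o xs) ⟩
      2 ^ suc a + (1 + itemWeight xs)             ≡⟨ +-suc (2 ^ suc a) _ ⟩
      1 + (2 ^ suc a + itemWeight xs)             ∎
      where open ≤-Reasoning

    pairUp′-≤ : ∀ {j f} o (P : Realizable arr j f) xs → 2 * itemWeight (pairUp′ o P xs) ≤ 2 + itemWeight xs
    pairUp′-≤ o P []                     = ≤-refl
    pairUp′-≤ o P (item f zero R ∷ xs)    = begin
      2 * (1 + itemWeight (pairUp o xs))  ≡⟨ *-distribˡ-+ 2 1 _ ⟩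
      2 + 2 * itemWeight (pairUp o xs)    ≤⟨ +-monoʳ-≤ 2 (pairUp-≤ o xs) ⟩
      2 + (1 + itemWeight xs)             ∎
      where open ≤-Reasoning
    pairUp′-≤ o P (item f (suc a) R ∷ xs) = begin
      2 * (2 ^ a + itemWeight (pairUp′ o P xs))     ≡⟨ *-distribˡ-+ 2 (2 ^ a) _ ⟩
      2 ^ suc a + 2 * itemWeight (pairUp′ o P xs)   ≤⟨ +-monoʳ-≤ (2 ^ suc a) (pairUp′-≤ o P xs) ⟩
      2 ^ suc a + (2 + itemWeight xs)               ≡⟨ +-suc (2 ^ suc a) _ ⟩
      1 + (2 ^ suc a + (1 + itemWeight xs))         ≡⟨ cong suc (+-suc (2 ^ suc a) _) ⟩
      2 + (2 ^ suc a + itemWeight xs)               ∎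
      where open ≤-Reasoning

  mutual
    pairUp-nonempty : ∀ {j} o x (xs : List (Item j)) → 0 < itemWeight (pairUp o (x ∷ xs))
    pairUp-nonempty o (item f zero R) xs    = pairUp′-nonempty o R xs
    pairUp-nonempty o (item f (suc a) R) xs = m≤n⇒m≤n+o _ (m^n>0 2 a)

    pairUp′-nonempty : ∀ {j f} o (P : Realizable arr j f) xs → 0 < itemWeight (pairUp′ o P xs)
    pairUp′-nonempty o P []                     = s≤s z≤n
    pairUp′-nonempty o P (item f zero R ∷ xs)    = s≤s z≤n
    pairUp′-nonempty o P (item f (suc a) R ∷ xs) = m≤n⇒m≤n+o _ (m^n>0 2 a)

  -- Kraft's inequality suffices for a balanced tree.
  realizable-itemFold : ∀ k {j} o (xs : List (Item j)) → 0 < itemWeight xs → itemWeight xs ≤ 2 ^ k →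
                        Realizable arr (k + j) (itemFold o xs)
  realizable-itemFold zero o (item f zero R ∷ []) _ _ =
    realizable-≗ (λ σ → sym (apply-identityʳ o (f σ))) R
  realizable-itemFold zero o (item f zero R ∷ x ∷ xs) _ w≤ =
    contradiction w≤ (<⇒≱ (s≤s (m≤n⇒m≤n+o _ (m^n>0 2 (lvl x)))))
  realizable-itemFold zero o (item f (suc a) R ∷ xs) _ w≤ =
    contradiction w≤ (<⇒≱ (m≤n⇒m≤n+o _ (*-monoʳ-≤ 2 (m^n>0 2 a))))
  realizable-itemFold (suc k) {j} o xs@(x ∷ xs′) _ w≤ =
    realizable-≗ (pairUp-fold o xs) (realizable-≤ (≤-reflexive (+-suc k j))
      (realizable-itemFold k o (pairUp o xs) (pairUp-nonempty o x xs′)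
        -- The excess 1 from `pairUp-≤` disappears because `2 ^ suc k` is even.
        (≮⇒≥ λ 2^k<w → <-irrefl refl (begin-strict
          2 * suc (2 ^ k)               ≤⟨ *-monoʳ-≤ 2 2^k<w ⟩
          2 * itemWeight (pairUp o xs)  ≤⟨ pairUp-≤ o xs ⟩
          1 + itemWeight xs             ≤⟨ s≤s w≤ ⟩
          1 + 2 * 2 ^ k                 <⟨ ≤-refl ⟩
          2 + 2 * 2 ^ k                 ≡⟨ *-suc 2 (2 ^ k) ⟨
          2 * suc (2 ^ k)               ∎))))
    where open ≤-Reasoning

  -- Lists of inputs, and paths below a computed function.

  listWeight : List (Fin m) → ℕ
  listWeight = sum ∘ map (λ i → 2 ^ arr i)

  listWeight-++ : ∀ is js → listWeight (is ++ js) ≡ listWeight is + listWeight js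
  listWeight-++ is js = trans (cong sum (map-++ _ is js)) (sum-++ (map _ is) _)

  0<listWeight-∷ʳ : ∀ is i → 0 < listWeight (is ++ [ i ])
  0<listWeight-∷ʳ is i = subst (0 <_) (sym (listWeight-++ is [ i ]))
    (m≤n⇒m≤o+n (listWeight is) (m≤n⇒m≤n+o 0 (m^n>0 2 (arr i))))

  listWeight-flatten : ∀ ps → listWeight (map proj₁ ps) ≤ listWeight (flatten ps)
  listWeight-flatten []             = z≤n
  listWeight-flatten ((i , j) ∷ ps) =
    +-monoʳ-≤ (2 ^ arr i) (≤-trans (listWeight-flatten ps) (m≤n+m _ (2 ^ arr j)))

  inputItem : Fin m → Item 0
  inputItem i = item (λ σ → σ i) (arr i) (realizable-≤ (m≤m+n _ 0) (realizable-input arr i))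

  itemWeight-inputs : ∀ is → itemWeight (map inputItem is) ≡ listWeight is
  itemWeight-inputs []       = refl
  itemWeight-inputs (i ∷ is) = cong (2 ^ arr i +_) (itemWeight-inputs is)

  itemFold-inputs : ∀ o is σ → itemFold o (map inputItem is) σ ≡ fold o (map σ is)
  itemFold-inputs o []       σ = refl
  itemFold-inputs o (i ∷ is) σ = cong (apply o (σ i)) (itemFold-inputs o is σ)

  realizable-fold : ∀ k o is → 0 < listWeight is → listWeight is ≤ 2 ^ k →
                    Realizable arr k (λ σ → fold o (map σ is))
  realizable-fold k o is 0<w w≤ =
    realizable-≗ (itemFold-inputs o is) (realizable-≤ (≤-reflexive (+-identityʳ k))
      (realizable-itemFold k o (map inputItem is)
        (subst (0 <_) (sym (itemWeight-inputs is)) 0<w)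
        (subst (_≤ 2 ^ k) (sym (itemWeight-inputs is)) w≤)))

  -- The path below an input f that is itself computed by a circuit; 2 ^ k plays the role of the weight of f.
  prefixed : Op → BooleanFunction m → List (Fin m) → BooleanFunction m
  prefixed o f is σ = apply o (f σ) (path (dual o) (map σ is))

  prefixed-[] : ∀ {d} o {f} → Realizable arr d f → Realizable arr d (prefixed o f [])
  prefixed-[] o {f} = realizable-≗ λ σ →
    sym (trans (cong (λ o′ → apply o (f σ) (unit o′)) (dual-involutive o)) (apply-identityʳ o (f σ)))

  -- Grinchuk's identity for the path below `f`; associativity of `o` moves `f` into the left
  -- factor.
  realizable-split : ∀ {e} o {f} ps c r → Realizable arr e (prefixed o f (flatten ps)) →
                     Realizable arr e (prefixed (dual o) (λ σ → fold (dual o) (map σ (map proj₁ ps ++ [ c ]))) r) →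
                     Realizable arr (suc e) (prefixed o f (flatten ps ++ c ∷ r))
  realizable-split o {f} ps c r left right = realizable-≗ (λ σ → begin
    apply o (apply o (f σ) _) (apply (dual o) _ (path (dual (dual o)) (map σ r)))
      ≡⟨ apply-assoc o (f σ) _ _ ⟩
    apply o (f σ) (apply o (path (dual o) (map σ (flatten ps))) _)
      ≡⟨ cong (λ o′ → apply o (f σ) (apply o′ (path (dual o) (map σ (flatten ps))) (right′ σ))) (dual-involutive o) ⟨
    apply o (f σ) (apply (dual (dual o)) (path (dual o) (map σ (flatten ps))) _)
      ≡⟨ cong (apply o (f σ)) (path-split (dual o) σ ps c r) ⟨
    apply o (f σ) (path (dual o) (map σ (flatten ps ++ c ∷ r)))
      ∎) (realizable-gate o left right)
    where
    open ≡-Reasoning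
    right′ = prefixed (dual o) (λ σ → fold (dual o) (map σ (map proj₁ ps ++ [ c ]))) r

  realizable-prefixed-fold : ∀ {e} o is → 0 < listWeight is → listWeight is ≤ 2 ^ e →
                             Realizable arr e (prefixed o (λ σ → fold o (map σ is)) [])
  realizable-prefixed-fold {e} o is 0<w w≤ = prefixed-[] o (realizable-fold e o is 0<w w≤)

  -- A path of one input is that input, so `l` simply joins the fold.
  realizable-prefixed-fold₁ : ∀ {e} o is l → listWeight (is ++ [ l ]) ≤ 2 ^ e →
                              Realizable arr e (prefixed o (λ σ → fold o (map σ is)) [ l ])
  realizable-prefixed-fold₁ {e} o is l w≤ =
    realizable-≗ fold≗ (realizable-fold e o (is ++ [ l ]) (0<listWeight-∷ʳ is l) w≤)
    where
    open ≡-Reasoning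
    fold≗ : ∀ σ → fold o (map σ (is ++ [ l ])) ≡ prefixed o (λ σ → fold o (map σ is)) [ l ] σ
    fold≗ σ = begin
      fold o (map σ (is ++ [ l ]))                             ≡⟨ cong (fold o) (map-++ σ is [ l ]) ⟩
      fold o (map σ is ++ [ σ l ])                             ≡⟨ fold-++ o (map σ is) [ σ l ] ⟩
      apply o (fold o (map σ is)) (apply o (σ l) (unit o))     ≡⟨ cong (apply o _) (apply-identityʳ o (σ l)) ⟩
      apply o (fold o (map σ is)) (σ l)                        ≡⟨ cong (apply o _) (apply-identityʳ (dual o) (σ l)) ⟨
      apply o (fold o (map σ is)) (apply (dual o) (σ l) (unit (dual o)))
        ≡⟨ cong (λ o′ → apply o (fold o (map σ is)) (apply (dual o) (σ l) (unit o′))) (dual-involutive (dual o)) ⟨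
      prefixed o (λ σ → fold o (map σ is)) [ l ] σ             ∎

  -- The induction on the delay.

  PrefixedRealizable : ℕ → Set
  PrefixedRealizable d = ∀ o {f} k is l → Realizable arr k f →
    2 ^ k + 2 * 2 ^ arr l + 2 * d * listWeight is ≤ 2 ^ d →
    Realizable arr d (prefixed o f (is ++ [ l ]))

  odd-weight : ∀ ps js → listWeight (map proj₁ ps ++ js) ≤ listWeight (flatten ps) + listWeight js
  odd-weight ps js = ≤-trans (≤-reflexive (listWeight-++ (map proj₁ ps) js))
                             (+-monoˡ-≤ (listWeight js) (listWeight-flatten ps))

  -- Moves the longest prefix (of even length) that the left subcircuit can afford into flatten ps.
  module _ {e} (ih : PrefixedRealizable e) (o : Op) {f} k (l : Fin m) (R : Realizable arr k f) where

    realizable-search : ∀ ps is → Realizable arr e (prefixed o f (flatten ps)) →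
      2 ^ k + 2 * 2 ^ arr l + (2 + 2 * e) * listWeight (flatten ps ++ is) ≤ 2 * 2 ^ e →
      Realizable arr (suc e) (prefixed o f (flatten ps ++ (is ++ [ l ])))
    -- No input is left before `l`, which takes the role of `c`; the path of the right factor is
    -- empty.
    realizable-search ps [] left total =
      realizable-split o ps l [] left
        (realizable-prefixed-fold (dual o) (map proj₁ ps ++ [ l ]) (0<listWeight-∷ʳ (map proj₁ ps) l)
          (tree-bound (2 ^ k) (2 * e) (listWeight (flatten ps)) (2 ^ arr l)
            (≤-trans (odd-weight ps [ l ]) (≤-reflexive (cong (listWeight (flatten ps) +_) (+-identityʳ _))))
            (subst (λ w → 2 ^ k + 2 * 2 ^ arr l + (2 + 2 * e) * w ≤ 2 * 2 ^ e)
              (trans (listWeight-++ (flatten ps) []) (+-identityʳ _)) total)))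
    -- Only `l` follows `c`, so the right factor is a balanced tree that contains both.
    realizable-search ps (c ∷ []) left total =
      realizable-split o ps c [ l ] left
        (realizable-prefixed-fold₁ (dual o) (map proj₁ ps ++ [ c ]) l
          (tree-bound (2 ^ k) (2 * e) (listWeight (flatten ps ++ [ c ])) (2 ^ arr l)
            (begin
              listWeight ((map proj₁ ps ++ [ c ]) ++ [ l ])
                ≡⟨ listWeight-++ (map proj₁ ps ++ [ c ]) [ l ] ⟩
              listWeight (map proj₁ ps ++ [ c ]) + (2 ^ arr l + 0)
                ≤⟨ +-mono-≤ (odd-weight ps [ c ]) (≤-reflexive (+-identityʳ _)) ⟩
              listWeight (flatten ps) + listWeight [ c ] + 2 ^ arr l
                ≡⟨ cong (_+ 2 ^ arr l) (listWeight-++ (flatten ps) [ c ]) ⟨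
              listWeight (flatten ps ++ [ c ]) + 2 ^ arr l ∎)
            total))
      where open ≤-Reasoning
    realizable-search ps (c ∷ b ∷ is) left total
      -- The next longer prefix ends with `b`, which as last input enters with coefficient 2 instead
      -- of `2 * e`.
      with 2 ^ k + 2 * 2 ^ arr b + 2 * e * listWeight (flatten ps ++ [ c ]) ≤? 2 ^ e
    ... | yes fits =
      subst (λ js → Realizable arr (suc e) (prefixed o f js)) (regroup (is ++ [ l ]))
        (realizable-search (ps ++ [ c , b ]) is
          (subst (λ js → Realizable arr e (prefixed o f js))
            (trans (++-assoc (flatten ps) [ c ] [ b ]) (sym (flatten-∷ʳ ps c b)))
            (ih o k (flatten ps ++ [ c ]) b R fits))
          (subst (λ js → 2 ^ k + 2 * 2 ^ arr l + (2 + 2 * e) * listWeight js ≤ 2 * 2 ^ e) (sym (regroup is)) total))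
      where
      regroup : ∀ js → flatten (ps ++ [ c , b ]) ++ js ≡ flatten ps ++ c ∷ b ∷ js
      regroup js = trans (cong (_++ js) (flatten-∷ʳ ps c b)) (++-assoc (flatten ps) (c ∷ b ∷ []) js)
    -- The split is made here. The fold is built with delay `k′`, and rounding its weight up to
    -- `2 ^ k′` at most doubles it.
    ... | no fails with ceilLog _ (0<listWeight-∷ʳ (map proj₁ ps) c)
    ...   | k′ , ω≤2^k′ , 2^k′≤2ω =
      realizable-split o ps c (b ∷ is ++ [ l ]) left
        (ih (dual o) k′ (b ∷ is) l
          (realizable-fold k′ (dual o) (map proj₁ ps ++ [ c ]) (0<listWeight-∷ʳ (map proj₁ ps) c) ω≤2^k′)
          (right-bound {E = 2 * e} (2 ^ k) (listWeight (flatten ps)) (2 ^ arr c) (2 ^ arr b) (listWeight is) (2 ^ arr l)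
            2^k′≤2ω
            (≤-trans (odd-weight ps [ c ]) (≤-reflexive (cong (listWeight (flatten ps) +_) (+-identityʳ _))))
            (subst (λ w → ¬ (2 ^ k + 2 * 2 ^ arr b + 2 * e * w ≤ 2 ^ e))
              (trans (listWeight-++ (flatten ps) [ c ]) (cong (listWeight (flatten ps) +_) (+-identityʳ _))) fails)
            (subst (λ w → 2 ^ k + 2 * 2 ^ arr l + (2 + 2 * e) * w ≤ 2 * 2 ^ e)
              (listWeight-++ (flatten ps) (c ∷ b ∷ is)) total)))

  -- The hypothesis is needed for all `o` and `f` at once, as the right factor is a path of the dual
  -- kind below a new leading function.
  realizable-prefixed : ∀ d → PrefixedRealizable d
  realizable-prefixed zero o k is l R total =
    -- For `d = 0` the left side is at least 3, the right side 1.
    contradiction (≤-trans (+-monoˡ-≤ 0 (+-mono-≤ (m^n>0 2 k) (*-monoʳ-≤ 2 (m^n>0 2 (arr l))))) total)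
                  λ { (s≤s ()) }
  realizable-prefixed (suc e) o k is l R total =
    realizable-search (realizable-prefixed e) o k l R [] is
      (prefixed-[] o (realizable-≤ k≤e R))
      (subst (λ D → 2 ^ k + 2 * 2 ^ arr l + D * listWeight is ≤ 2 ^ suc e) (*-suc 2 e) total)
    where
    -- The search starts with the empty prefix, whose left factor is `f` alone. The positive weight
    -- of `l` makes `2 ^ k` strictly less than `2 ^ suc e`.
    k≤e : k ≤ e
    k≤e = ≮⇒≥ λ e<k → <⇒≱
      (begin-strict
        2 ^ k                                           <⟨ m<m+n (2 ^ k) (m≤n⇒m≤n+o _ (m^n>0 2 (arr l))) ⟩
        2 ^ k + 2 * 2 ^ arr l                           ≤⟨ m≤m+n _ _ ⟩
        2 ^ k + 2 * 2 ^ arr l + 2 * suc e * listWeight is  ≤⟨ total ⟩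
        2 ^ suc e                                       ∎)
      (^-monoʳ-≤ 2 e<k)
      where open ≤-Reasoning

  -- The first input serves as `f` and the last one as `l`; their coefficients 1 and 2 in the
  -- condition do not exceed `2 * suc d`.
  realizable-path : ∀ d i is → 0 < length is → 2 * suc d * listWeight (i ∷ is) ≤ 2 ^ suc d →
                    Realizable arr (suc d) (λ σ → path AND (map σ (i ∷ is)))
  realizable-path d i is 0<n w≤ with initLast is
  realizable-path d i .[] () w≤ | []
  realizable-path d i .(is ++ [ l ]) 0<n w≤ | is ∷ʳ′ l =
    realizable-prefixed (suc d) AND (arr i) is l (realizable-input arr i) (begin
    x + 2 * z + D * y                  ≤⟨ m≤m+n _ (d * (2 * x + 2 * z) + x) ⟩
    x + 2 * z + D * y + (d * (2 * x + 2 * z) + x)  ≡⟨ rearrange x y z d ⟩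
    D * (x + (y + (z + 0)))            ≡⟨ cong (λ w → D * (x + w)) (listWeight-++ is [ l ]) ⟨
    D * listWeight (i ∷ is ++ [ l ])   ≤⟨ w≤ ⟩
    2 ^ suc d                          ∎)
    where
    open ≤-Reasoning
    D = 2 * suc d
    x = 2 ^ arr i
    y = listWeight is
    z = 2 ^ arr l
    rearrange : ∀ x y z d → x + 2 * z + 2 * suc d * y + (d * (2 * x + 2 * z) + x) ≡
                            2 * suc d * (x + (y + (z + 0)))
    rearrange = solve-∀

  -- The weight bound forces every arrival time to be at most `A`; evaluation from the end of the
  -- path then costs one gate per further input.
  realizable-chain : ∀ o i is A → listWeight (i ∷ is) < 2 ^ suc A →
                     Realizable arr (length is + A) (λ σ → path o (map σ (i ∷ is)))
  realizable-chain o i is A w< = chain is w<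
    where
    arr≤A : arr i ≤ A
    arr≤A = ≮⇒≥ λ A<a → <⇒≱ (≤-<-trans (m≤m+n _ _) w<) (^-monoʳ-≤ 2 A<a)
    chain : ∀ is → listWeight (i ∷ is) < 2 ^ suc A →
            Realizable arr (length is + A) (λ σ → path o (map σ (i ∷ is)))
    chain [] _ = realizable-≗
      (λ σ → sym (trans (cong (λ o′ → apply o (σ i) (unit o′)) (dual-involutive o)) (apply-identityʳ o (σ i))))
      (realizable-≤ arr≤A (realizable-input arr i))
    chain (j ∷ js) w< = realizable-gate o
      (realizable-≤ (≤-trans arr≤A (m≤n+m A (length js))) (realizable-input arr i))
      (realizable-chain (dual o) j js A (≤-<-trans (m≤n+m _ (2 ^ arr i)) w<))

  weight≡listWeight : weight m arr ≡ listWeight (allFin m)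
  weight≡listWeight = cong sum (sym (map-tabulate id (λ i → 2 ^ arr i)))

  length≤listWeight : ∀ is → length is ≤ listWeight is
  length≤listWeight []       = z≤n
  length≤listWeight (i ∷ is) = +-mono-≤ (m^n>0 2 (arr i)) (length≤listWeight is)

  m≤weight : m ≤ weight m arr
  m≤weight = subst (m ≤_) (sym weight≡listWeight)
    (subst (_≤ listWeight (allFin m)) (length-tabulate id) (length≤listWeight (allFin m)))

andOrPath≗path : ∀ n σ → path AND (map σ (allFin (suc n))) ≡ andOrPath (suc n) σ
andOrPath≗path n σ = trans (path-andOr (σ zero) (map σ (tabulate suc)))
  (cong andOr (map-tabulate id σ))

-- Rounding the arrival times.

listWeight-∸ : ∀ {m} (arr : Fin m → ℕ) r is →
               listWeight (λ i → arr i ∸ r) is * 2 ^ r ≤ listWeight arr is + length is * 2 ^ r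
listWeight-∸ arr r []       = z≤n
listWeight-∸ arr r (i ∷ is) = begin
  (2 ^ (arr i ∸ r) + listWeight (λ i → arr i ∸ r) is) * 2 ^ r          ≡⟨ *-distribʳ-+ (2 ^ r) (2 ^ (arr i ∸ r)) (listWeight (λ i → arr i ∸ r) is) ⟩
  2 ^ (arr i ∸ r) * 2 ^ r + listWeight (λ i → arr i ∸ r) is * 2 ^ r    ≤⟨ +-mono-≤ (term (arr i)) (listWeight-∸ arr r is) ⟩
  2 ^ arr i + 2 ^ r + (listWeight arr is + length is * 2 ^ r)
    ≡⟨ rearrange (2 ^ arr i) (2 ^ r) (listWeight arr is) (length is * 2 ^ r) ⟩
  2 ^ arr i + listWeight arr is + (2 ^ r + length is * 2 ^ r)  ∎
  where
  open ≤-Reasoning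
  rearrange : ∀ a b c d → a + b + (c + d) ≡ a + c + (b + d)
  rearrange = solve-∀
  -- The left side is the maximum of `2 ^ a` and `2 ^ r`.
  term : ∀ a → 2 ^ (a ∸ r) * 2 ^ r ≤ 2 ^ a + 2 ^ r
  term a with ≤-total r a
  ... | inj₁ r≤a = begin
    2 ^ (a ∸ r) * 2 ^ r  ≡⟨ ^-distribˡ-+-* 2 (a ∸ r) r ⟨
    2 ^ (a ∸ r + r)      ≡⟨ cong (2 ^_) (m∸n+n≡m r≤a) ⟩
    2 ^ a                ≤⟨ m≤m+n _ _ ⟩
    2 ^ a + 2 ^ r        ∎
  ... | inj₂ a≤r rewrite m≤n⇒m∸n≡0 a≤r = ≤-trans (≤-reflexive (*-identityˡ _)) (m≤n+m _ (2 ^ a))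

-- From a delay to the bound with logarithms.

^-distribʳ-* : ∀ m n o → (m * n) ^ o ≡ m ^ o * n ^ o
^-distribʳ-* m n zero    = refl
^-distribʳ-* m n (suc o) = trans (cong (m * n *_) (^-distribʳ-* m n o)) (rearrange m n (m ^ o) (n ^ o))
  where
  rearrange : ∀ a b c d → a * b * (c * d) ≡ a * c * (b * d)
  rearrange = solve-∀

abstract
  19^10≤2^43 : 19 ^ 10 ≤ 2 ^ 43
  19^10≤2^43 = from-yes (19 ^ 10 ≤? 2 ^ 43)

-- Since 19 < 2 ^ 4.3, it suffices to bound 2 ^ d for one fixed pair of rationals a / b < log₂ m and c / e < log₂ (a / b).
boundHolds : ∀ m W d a b c e → 0 < b → 0 < e → 2 ^ a < m ^ b → 2 ^ c * b ^ e < a ^ e →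
             2 ^ d * (b * e) ≤ 19 * W * (a * c) → BoundHolds m W d
boundHolds m W d a b c e 0<b 0<e u< v< bound s t 0<t s<t =
  a , b , c , e , 0<b , 0<e , u< , v< , ≰⇒> λ t≤s →
    -- If `t * p ^ 10 ≤ s * q ^ 10`, the tenth power of `bound` refutes `s<t`, once both sides are
    -- multiplied by `q ^ 10`.
    <⇒≱ s<t (*-cancelʳ-≤ _ _ (q ^ 10) {{m^n≢0 q 10 {{q≢0}}}} (begin
      t * 2 ^ (10 * d) * q ^ 10          ≡⟨ *-assoc t _ _ ⟩
      t * (2 ^ (10 * d) * q ^ 10)        ≤⟨ *-monoʳ-≤ t powers ⟩
      t * (19 ^ 10 * W ^ 10 * p ^ 10)    ≡⟨ rearrange t (19 ^ 10) (W ^ 10) (p ^ 10) ⟩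
      t * p ^ 10 * (19 ^ 10 * W ^ 10)    ≤⟨ *-mono-≤ t≤s (*-monoˡ-≤ (W ^ 10) 19^10≤2^43) ⟩
      s * q ^ 10 * (2 ^ 43 * W ^ 10)     ≡⟨ rearrange′ s (q ^ 10) (2 ^ 43) (W ^ 10) ⟩
      s * 2 ^ 43 * W ^ 10 * q ^ 10       ∎))
  where
  open ≤-Reasoning
  p = a * c
  q = b * e
  q≢0 : NonZero q
  q≢0 = m*n≢0 b e {{>-nonZero 0<b}} {{>-nonZero 0<e}}
  powers : 2 ^ (10 * d) * q ^ 10 ≤ 19 ^ 10 * W ^ 10 * p ^ 10
  powers = begin
    2 ^ (10 * d) * q ^ 10        ≡⟨ cong (λ n → 2 ^ n * q ^ 10) (*-comm 10 d) ⟩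
    2 ^ (d * 10) * q ^ 10        ≡⟨ cong (_* q ^ 10) (^-*-assoc 2 d 10) ⟨
    (2 ^ d) ^ 10 * q ^ 10        ≡⟨ ^-distribʳ-* (2 ^ d) q 10 ⟨
    (2 ^ d * q) ^ 10             ≤⟨ ^-monoˡ-≤ 10 bound ⟩
    (19 * W * p) ^ 10            ≡⟨ ^-distribʳ-* (19 * W) p 10 ⟩
    (19 * W) ^ 10 * p ^ 10       ≡⟨ cong (_* p ^ 10) (^-distribʳ-* 19 W 10) ⟩
    19 ^ 10 * W ^ 10 * p ^ 10    ∎
  rearrange : ∀ t n w p → t * (n * w * p) ≡ t * p * (n * w)
  rearrange = solve-∀
  rearrange′ : ∀ s q n w → s * q * (n * w) ≡ s * n * w * q
  rearrange′ = solve-∀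

-- Paths with fewer than eight inputs.

FastCircuit : (m : ℕ) → (Fin m → ℕ) → Set
FastCircuit m arr = ∃[ C ] ∃[ d ] (Realizes C (andOrPath m) × DelayAtMost C arr d × BoundHolds m (weight m arr) d)

-- Taking the floor of log₂ W for `A`, the chain has delay `n + A`. As `2 ^ A ≤ W`, the arrival
-- times drop out of the remaining inequality.
chain-bound : ∀ n (arr : Fin (suc n) → ℕ) a b c e → 0 < b → 0 < e → 2 ^ a < suc n ^ b → 2 ^ c * b ^ e < a ^ e →
              2 ^ n * (b * e) ≤ 19 * (a * c) → FastCircuit (suc n) arr
chain-bound n arr a b c e 0<b 0<e u< v< bound
  with floorLog (weight (suc n) arr) (≤-trans (s≤s z≤n) (m≤weight arr))
... | A , 2^A≤W , W<2^1+A =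
  circuit R , n + A , realizes R , delayAtMost R , boundHolds (suc n) W (n + A) a b c e 0<b 0<e u< v< (begin
    2 ^ (n + A) * (b * e)        ≡⟨ cong (_* (b * e)) (^-distribˡ-+-* 2 n A) ⟩
    2 ^ n * 2 ^ A * (b * e)      ≡⟨ rearrange (2 ^ n) (2 ^ A) (b * e) ⟩
    2 ^ n * (b * e) * 2 ^ A      ≤⟨ *-mono-≤ bound 2^A≤W ⟩
    19 * (a * c) * W             ≡⟨ rearrange 19 (a * c) W ⟩
    19 * W * (a * c)             ∎)
  where
  open ≤-Reasoning
  W = weight (suc n) arr
  rearrange : ∀ x y z → x * y * z ≡ x * z * y
  rearrange = solve-∀
  R : Realizable arr (n + A) (andOrPath (suc n))
  R = realizable-≗ (andOrPath≗path n) (realizable-≤ (≤-reflexive (cong (_+ A) (length-tabulate {n = n} suc)))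
        (realizable-chain arr AND zero (tabulate suc) A
          (subst (_< 2 ^ suc A) (weight≡listWeight arr) W<2^1+A)))

-- Choice of the delay for at least eight inputs.

growth : ∀ i → 6 * i + 22 ≤ 32 * 4 ^ i
growth zero    = from-yes (22 ≤? 32)
growth (suc i) = begin
  6 * suc i + 22               ≤⟨ m≤m+n _ (18 * i + 60) ⟩
  6 * suc i + 22 + (18 * i + 60)  ≡⟨ rearrange i ⟩
  4 * (6 * i + 22)             ≤⟨ *-monoʳ-≤ 4 (growth i) ⟩
  4 * (32 * 4 ^ i)             ≡⟨ rearrange′ (4 ^ i) ⟩
  32 * (4 * 4 ^ i)             ∎
  where
  open ≤-Reasoning
  rearrange : ∀ i → 6 * suc i + 22 + (18 * i + 60) ≡ 4 * (6 * i + 22)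
  rearrange = solve-∀
  rearrange′ : ∀ x → 4 * (32 * x) ≡ 32 * (4 * x)
  rearrange′ = solve-∀

-- Delay `3 * i + 11` leaves a factor `2 ^ (2 * i + 5)`, that is `32 * 4 ^ i`, for twice the delay.
-- The delay is thus linear in log m.
enoughLevels : ∀ i V → V ≤ 2 ^ (i + 6) → 2 * suc (3 * i + 10) * V ≤ 2 ^ suc (3 * i + 10)
enoughLevels i V V≤ = begin
  2 * suc (3 * i + 10) * V            ≡⟨ cong (_* V) (rearrange i) ⟩
  (6 * i + 22) * V                    ≤⟨ *-mono-≤ (growth i) V≤ ⟩
  32 * 4 ^ i * 2 ^ (i + 6)            ≡⟨ cong (λ x → 32 * x * 2 ^ (i + 6)) (^-*-assoc 2 2 i) ⟩
  32 * 2 ^ (2 * i) * 2 ^ (i + 6)      ≡⟨ cong (_* 2 ^ (i + 6)) (*-comm 32 (2 ^ (2 * i))) ⟩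
  2 ^ (2 * i) * 2 ^ 5 * 2 ^ (i + 6)   ≡⟨ cong (_* 2 ^ (i + 6)) (^-distribˡ-+-* 2 (2 * i) 5) ⟨
  2 ^ (2 * i + 5) * 2 ^ (i + 6)       ≡⟨ ^-distribˡ-+-* 2 (2 * i + 5) (i + 6) ⟨
  2 ^ (2 * i + 5 + (i + 6))           ≡⟨ cong (2 ^_) (rearrange′ i) ⟩
  2 ^ suc (3 * i + 10)                ∎
  where
  open ≤-Reasoning
  rearrange : ∀ i → 2 * suc (3 * i + 10) ≡ 6 * i + 22
  rearrange = solve-∀
  rearrange′ : ∀ i → 2 * i + 5 + (i + 6) ≡ suc (3 * i + 10)
  rearrange′ = solve-∀

-- The chosen delay is one more than a delay at most `N` that violates the condition, so its power
-- of two exceeds `2 * N * V` by at most a factor of 2. The search starts at delay 1, where the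
-- violation is `1 < V`.
chooseDelay : ∀ N V → 1 < V → 2 * suc N * V ≤ 2 ^ suc N →
              ∃[ d ] (2 * suc d * V ≤ 2 ^ suc d × 2 ^ suc d ≤ 4 * N * V)
chooseDelay N V 1<V enough
  with crossing {λ k → 2 ^ suc k < 2 * suc k * V} (λ k → 2 ^ suc k <? 2 * suc k * V) N
                (*-monoʳ-< 2 1<V) (≤⇒≯ enough)
... | k , k<N , below , above = suc k , ≮⇒≥ above , (begin
  2 * 2 ^ suc k          ≤⟨ *-monoʳ-≤ 2 (<⇒≤ below) ⟩
  2 * (2 * suc k * V)    ≡⟨ rearrange (suc k) V ⟩
  4 * suc k * V          ≤⟨ *-monoˡ-≤ V (*-monoʳ-≤ 4 k<N) ⟩
  4 * N * V              ∎)
  where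
  open ≤-Reasoning
  rearrange : ∀ x V → 2 * (2 * x * V) ≡ 4 * x * V
  rearrange = solve-∀

-- `R` is `2 ^ r`, and `ℓ` here is the power of two below `m`, not its exponent. That `r` is
-- admissible gives the first bound; that `r` is maximal gives `V * R ≤ 4 * m * R` and so the
-- second.
rounded-bound : ∀ {V W m R ℓ} → .{{_ : NonZero R}} → V * R ≤ W + m * R → m * R ≤ W → W < m * (2 * R) → m ≤ 2 * ℓ →
                V * R ≤ 2 * W × V ≤ 8 * ℓ
rounded-bound {V} {W} {m} {R} {ℓ} V≤ m≤W W<2m m≤2ℓ = VR≤2W , *-cancelʳ-≤ V (8 * ℓ) R (begin
  V * R                    ≤⟨ VR≤2W ⟩
  2 * W                    ≤⟨ *-monoʳ-≤ 2 (<⇒≤ W<2m) ⟩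
  2 * (m * (2 * R))        ≤⟨ *-monoʳ-≤ 2 (*-monoˡ-≤ (2 * R) m≤2ℓ) ⟩
  2 * (2 * ℓ * (2 * R))    ≡⟨ rearrange ℓ R ⟩
  8 * ℓ * R                ∎)
  where
  open ≤-Reasoning
  rearrange : ∀ ℓ R → 2 * (2 * ℓ * (2 * R)) ≡ 8 * ℓ * R
  rearrange = solve-∀
  VR≤2W : V * R ≤ 2 * W
  VR≤2W = begin
    V * R        ≤⟨ V≤ ⟩
    W + m * R    ≤⟨ +-monoʳ-≤ W m≤W ⟩
    W + W        ≡⟨ cong (W +_) (+-identityʳ W) ⟨
    2 * W        ∎

-- The choice of the delay costs a factor 4 and rounding a factor 2. What remains is 480 i + 1600 ≤
-- 570 i + 1653.
delay-bound : ∀ {D V W R} i → D ≤ 4 * (3 * i + 10) * V → V * R ≤ 2 * W →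
              D * R * (10 * 2) ≤ 19 * W * ((10 * i + 29) * 3)
delay-bound {D} {V} {W} {R} i D≤ V≤ = begin
  D * R * 20                         ≤⟨ *-monoˡ-≤ 20 (*-monoˡ-≤ R D≤) ⟩
  4 * x * V * R * 20                 ≡⟨ rearrange x V R ⟩
  4 * x * 20 * (V * R)               ≤⟨ *-monoʳ-≤ (4 * x * 20) V≤ ⟩
  4 * x * 20 * (2 * W)               ≡⟨ rearrange′ x W ⟩
  x * 160 * W                        ≤⟨ *-monoˡ-≤ W constants ⟩
  y * 57 * W                         ≡⟨ rearrange″ y W ⟩
  19 * W * (y * 3)                   ∎
  where
  open ≤-Reasoning
  x = 3 * i + 10
  y = 10 * i + 29
  rearrange : ∀ x V R → 4 * x * V * R * 20 ≡ 4 * x * 20 * (V * R)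
  rearrange = solve-∀
  rearrange′ : ∀ x W → 4 * x * 20 * (2 * W) ≡ x * 160 * W
  rearrange′ = solve-∀
  rearrange″ : ∀ y W → y * 57 * W ≡ 19 * W * (y * 3)
  rearrange″ = solve-∀
  constants : x * 160 ≤ y * 57
  constants = ≤-trans (m≤m+n (x * 160) (i * 90 + 53)) (≤-reflexive (rearrange‴ i))
    where
    rearrange‴ : ∀ i → (3 * i + 10) * 160 + (i * 90 + 53) ≡ (10 * i + 29) * 57
    rearrange‴ = solve-∀

rounded-weight : ∀ {m} (arr : Fin m → ℕ) r →
                 weight m (λ j → arr j ∸ r) * 2 ^ r ≤ weight m arr + m * 2 ^ r
rounded-weight {m} arr r = begin
  weight m arr′ * 2 ^ r                                       ≡⟨ cong (_* 2 ^ r) (weight≡listWeight arr′) ⟩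
  listWeight arr′ (allFin m) * 2 ^ r                          ≤⟨ listWeight-∸ arr r (allFin m) ⟩
  listWeight arr (allFin m) + length (allFin m) * 2 ^ r
    ≡⟨ cong₂ (λ w k → w + k * 2 ^ r) (sym (weight≡listWeight arr)) (length-tabulate {n = m} id) ⟩
  weight m arr + m * 2 ^ r                                    ∎
  where
  open ≤-Reasoning
  arr′ : Fin m → ℕ
  arr′ j = arr j ∸ r

realizable-andOrPath : ∀ {n} (arr : Fin (2 + n) → ℕ) d → 2 * suc d * weight (2 + n) arr ≤ 2 ^ suc d →
                       Realizable arr (suc d) (andOrPath (2 + n))
realizable-andOrPath {n} arr d fits = realizable-≗ (andOrPath≗path (suc n))
  (realizable-path arr d zero (tabulate suc) (s≤s z≤n)
    (subst (λ w → 2 * suc d * w ≤ 2 ^ suc d) (weight≡listWeight arr) fits))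

delayAtMost-∸ : ∀ {m} (arr : Fin m → ℕ) {d f} r (R : Realizable (λ j → arr j ∸ r) d f) →
                DelayAtMost (circuit R) arr (d + r)
delayAtMost-∸ arr {d} r R j ℓ p = begin
  arr j + ℓ               ≤⟨ +-monoˡ-≤ ℓ (m≤n+m∸n (arr j) r) ⟩
  r + (arr j ∸ r) + ℓ     ≡⟨ +-assoc r _ ℓ ⟩
  r + ((arr j ∸ r) + ℓ)   ≤⟨ +-monoʳ-≤ r (delayAtMost R j ℓ p) ⟩
  r + d                   ≡⟨ +-comm r d ⟩
  d + r                   ∎
  where open ≤-Reasoning

-- Subtracting 1/10 from the exponent makes the inequality strict even when `m` is a power of two.
u-certificate : ∀ {m} i → 2 ^ (i + 3) ≤ m → 2 ^ (10 * i + 29) < m ^ 10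
u-certificate {m} i 2^ℓ≤m = begin-strict
  2 ^ (10 * i + 29)      <⟨ ^-monoʳ-< 2 ≤-refl (+-monoʳ-< (10 * i) (n<1+n 29)) ⟩
  2 ^ (10 * i + 30)      ≡⟨ cong (2 ^_) (rearrange i) ⟩
  2 ^ ((i + 3) * 10)     ≡⟨ ^-*-assoc 2 (i + 3) 10 ⟨
  (2 ^ (i + 3)) ^ 10     ≤⟨ ^-monoˡ-≤ 10 2^ℓ≤m ⟩
  m ^ 10                 ∎
  where
  open ≤-Reasoning
  rearrange : ∀ i → 10 * i + 30 ≡ (i + 3) * 10
  rearrange = solve-∀

-- The smallest case `i = 0` reads 800 < 841.
v-certificate : ∀ i → 2 ^ 3 * 10 ^ 2 < (10 * i + 29) ^ 2
v-certificate i = ≤-trans (from-yes (2 ^ 3 * 10 ^ 2 <? 29 ^ 2)) (^-monoˡ-≤ 2 (m≤n+m 29 (10 * i)))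

-- The bound is certified by a / b = ℓ - 1/10 and c / e = 3/2, where ℓ = i + 3.
split-bound : ∀ n (arr : Fin (2 + n) → ℕ) i → 2 ^ (i + 3) ≤ 2 + n → 2 + n < 2 * 2 ^ (i + 3) →
              FastCircuit (2 + n) arr
-- The exponent 0 is admissible because every weight is at least 1, and the exponent `W` is not
-- because `W < 2 ^ W`.
split-bound n arr i 2^ℓ≤m m<2^1+ℓ = round (crossing (λ r → m * 2 ^ r ≤? W) W
    (subst (_≤ W) (sym (*-identityʳ m)) (m≤weight arr)) (<⇒≱ (≤-trans (n<2^n W) (m≤n*m (2 ^ W) m))))
  where
  m = 2 + n
  W = weight m arr

  8·2^ℓ≡ : 8 * 2 ^ (i + 3) ≡ 2 ^ (i + 6)
  8·2^ℓ≡ = trans (sym (^-distribˡ-+-* 2 3 (i + 3))) (cong (2 ^_) (trans (+-comm 3 (i + 3)) (+-assoc i 3 3)))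

  module _ (r : ℕ) where
    arr′ : Fin m → ℕ
    arr′ j = arr j ∸ r
    V = weight m arr′

    finish : V * 2 ^ r ≤ 2 * W → ∃[ d ] (2 * suc d * V ≤ 2 ^ suc d × 2 ^ suc d ≤ 4 * (3 * i + 10) * V) → FastCircuit m arr
    finish V2^r≤2W (d , fits , 2^d≤) =
      circuit R , suc d + r , realizes R , delayAtMost-∸ arr r R ,
      boundHolds m W (suc d + r) (10 * i + 29) 10 3 2 (s≤s z≤n) (s≤s z≤n) (u-certificate i 2^ℓ≤m) (v-certificate i)
        (≤-trans (≤-reflexive (cong (_* (10 * 2)) (^-distribˡ-+-* 2 (suc d) r))) (delay-bound {W = W} i 2^d≤ V2^r≤2W))
      where
      R : Realizable arr′ (suc d) (andOrPath m)
      R = realizable-andOrPath arr′ d fits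

  round : ∃[ r ] (r < W × m * 2 ^ r ≤ W × ¬ (m * 2 ^ suc r ≤ W)) → FastCircuit m arr
  round (r , _ , m2^r≤W , ¬m2^1+r≤W) =
    let V2^r≤2W , V≤8·2^ℓ = rounded-bound {W = W} {ℓ = 2 ^ (i + 3)} {{m^n≢0 2 r}} (rounded-weight arr r) m2^r≤W
                              (≰⇒> ¬m2^1+r≤W) (<⇒≤ m<2^1+ℓ)
    in finish r V2^r≤2W (chooseDelay (3 * i + 10) (V r) (≤-trans (s≤s (s≤s z≤n)) (m≤weight (arr′ r)))
         (enoughLevels i (V r) (≤-trans V≤8·2^ℓ (≤-reflexive 8·2^ℓ≡))))

theorem4p1 : (m : ℕ) → 3 ≤ m → (arr : Fin m → ℕ) →
    ∃[ C ] ∃[ d ] (Realizes C (andOrPath m) × DelayAtMost C arr d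
    × BoundHolds m (weight m arr) d)
-- Lower bounds 3/2 for log₂ m and 1/2 for log₂ (3/2) suffice for 3 and 4 inputs.
theorem4p1 3 _ arr = chain-bound 2 arr 3 2 1 2 (s≤s z≤n) (s≤s z≤n)
  (from-yes (2 ^ 3 <? 3 ^ 2)) (from-yes (2 ^ 1 * 2 ^ 2 <? 3 ^ 2)) (from-yes (2 ^ 2 * (2 * 2) ≤? 19 * (3 * 1)))
theorem4p1 4 _ arr = chain-bound 3 arr 3 2 1 2 (s≤s z≤n) (s≤s z≤n)
  (from-yes (2 ^ 3 <? 4 ^ 2)) (from-yes (2 ^ 1 * 2 ^ 2 <? 3 ^ 2)) (from-yes (2 ^ 3 * (2 * 2) ≤? 19 * (3 * 1)))
-- For 5 and 6 inputs the bounds are 9/4 and 1.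
theorem4p1 5 _ arr = chain-bound 4 arr 9 4 1 1 (s≤s z≤n) (s≤s z≤n)
  (from-yes (2 ^ 9 <? 5 ^ 4)) (from-yes (2 ^ 1 * 4 ^ 1 <? 9 ^ 1)) (from-yes (2 ^ 4 * (4 * 1) ≤? 19 * (9 * 1)))
theorem4p1 6 _ arr = chain-bound 5 arr 9 4 1 1 (s≤s z≤n) (s≤s z≤n)
  (from-yes (2 ^ 9 <? 6 ^ 4)) (from-yes (2 ^ 1 * 4 ^ 1 <? 9 ^ 1)) (from-yes (2 ^ 5 * (4 * 1) ≤? 19 * (9 * 1)))
-- With 9/4 and 1 the last inequality would read 256 ≤ 171; the finer 14/5 and 7/5 turn it into 1600
-- ≤ 1862.
theorem4p1 7 _ arr = chain-bound 6 arr 14 5 7 5 (s≤s z≤n) (s≤s z≤n)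
  (from-yes (2 ^ 14 <? 7 ^ 5)) (from-yes (2 ^ 7 * 5 ^ 5 <? 14 ^ 5)) (from-yes (2 ^ 6 * (5 * 5) ≤? 19 * (14 * 7)))
theorem4p1 m@(suc (suc (suc (suc (suc (suc (suc (suc n)))))))) _ arr with floorLog m (s≤s z≤n)
-- As m ≥ 8, the floor of log₂ m is at least 3 and has the form `i + 3`.
... | suc (suc (suc i)) , 2^ℓ≤m , m<2^1+ℓ = split-bound (6 + n) arr i (subst (λ ℓ → 2 ^ ℓ ≤ m) (+-comm 3 i) 2^ℓ≤m) (subst (λ ℓ → m < 2 * 2 ^ ℓ) (+-comm 3 i) m<2^1+ℓ)
... | 0 , _ , m<2 = contradiction m<2 (≤⇒≯ (m≤m+n 2 (6 + n)))
... | 1 , _ , m<4 = contradiction m<4 (≤⇒≯ (m≤m+n 4 (4 + n)))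
... | 2 , _ , m<8 = contradiction m<8 (≤⇒≯ (m≤m+n 8 n))
theorem4p1 2 (s≤s (s≤s ())) arr
theorem4p1 1 (s≤s ()) arr
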